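{- The generating function $$F_{(213,231)}(x,p,q,u,v,s,t)=\sum_{n\ge0}\ \sum_{\pi\in S_n(213,231)} x^n p^{\operatorname{asc}(\pi)}q^{\operatorname{des}(\pi)}u^{\operatorname{lrmax}(\pi)}v^{\operatorname{rlmax}(\pi)}s^{\operatorname{lrmin}(\pi)}t^{\operatorname{rlmin}(\pi)}$$ is equal to $\dfrac{A}{(1-ptux)(1-ptx-qvx)(1-qsvx)}$, where $$\begin{aligned}A={}&1 - p t x - p t u x - q v x - q s v x + s t u v x + p^2 t^2 u x^2 + p q s t v x^2 + p q t u v x^2 + p q s t u v x^2 - p s t^2 u v x^2 + q^2 s v^2 x^2\\ &- q s t u v^2 x^2 - p^2 q s t^2 u v x^3 - p q^2 s t u v^2 x^3 + p q s^2 t^2 u v^2 x^3 + p q s t^2 u^2 v^2 x^3 - p q s^2 t^2 u^2 v^2 x^3.\end{aligned}$$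
   Context: For $n\ge 0$, $S_n$ denotes the set of permutations $\pi=\pi_1\cdots\pi_n$ of $[n]=\{1,\dots,n\}$ ($S_0$ consists of the empty permutation, for which all statistics are $0$). $\pi$ avoids a pattern $\tau\in S_k$ if no subsequence $\pi_{i_1}\cdots\pi_{i_k}$ ($i_1<\dots<i_k$) satisfies $\pi_{i_a}<\pi_{i_b}\iff\tau_a<\tau_b$; $S_n(\tau,\rho)$ is the set of permutations in $S_n$ avoiding both $\tau$ and $\rho$. $\operatorname{asc}(\pi)$ (resp. $\operatorname{des}(\pi)$) is the number of $i\in[n-1]$ with $\pi_i<\pi_{i+1}$ (resp. $\pi_i>\pi_{i+1}$). $\pi_i$ is a left-to-right maximum (resp. minimum) if it is larger (resp. smaller) than every $\pi_j$ with $j<i$, and a right-to-left maximum (resp. minimum) if it is larger (resp. smaller) than every $\pi_j$ with $j>i$; $\operatorname{lrmax},\operatorname{lrmin},\operatorname{rlmax},\operatorname{rlmin}$ count these. -}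

module Defs where

open import Algebra.Bundles using (CommutativeRing)
import Algebra.Properties.Semiring.Exp as Exp
import Algebra.Properties.Semiring.Sum as Sum
open import Data.Fin.Base using (Fin; toℕ; _<_)
open import Data.Fin.Patterns using (0F; 1F; 2F)
open import Data.Fin.Properties using (_≟_; _<?_; any?; all?)
open import Data.List.Base as List using (List; []; _∷_; allFin; cartesianProductWith; filter; length)
open import Data.Nat.Base using (ℕ; zero; suc; _∸_)
import Data.Nat.Properties as ℕ
open import Data.Product.Base using (∃; _×_; _,_)
open import Data.Vec.Base using (Vec; []; _∷_; lookup)
open import Data.Vec.Relation.Unary.AllPairs using (allPairs?)
open import Data.Vec.Relation.Unary.Unique.Propositional using (Unique)
open import Function.Base using (_∘_)
open import Function.Bundles using (_⇔_; mk⇔; Equivalence)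
open import Level using (Level)
open import Relation.Binary.PropositionalEquality.Core using (_≡_)
open import Relation.Nullary.Decidable using (Dec; ¬?; map′; _×-dec_; _→-dec_)
open import Relation.Nullary.Negation using (¬_)
open import Relation.Unary using (Pred; Decidable)

private
  variable
    a ℓ : Level
    A B : Set a
    k n : ℕ

------------------------------------------------------------------------
-- Permutations in one-line notation

-- Positions and values are numbered from 0, so a permutation of [n] is a
-- word of length n in Fin n without repeated letters.
Word : ℕ → Set
Word n = Vec (Fin n) n

IsPermutation : Pred (Word n) _
IsPermutation π = Unique π

isPermutation? : Decidable (IsPermutation {n})
isPermutation? = allPairs? (λ i j → ¬? (i ≟ j))

vectors : ∀ n k → List (Vec (Fin n) k)
vectors n zero    = [] ∷ []
vectors n (suc k) = cartesianProductWith _∷_ (allFin n) (vectors n k)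

------------------------------------------------------------------------
-- Pattern avoidance

Increasing : Pred (Vec (Fin n) k) _
Increasing is = ∀ a b → a < b → lookup is a < lookup is b

-- `is` lists the positions i₁, …, iₖ.
IsOccurrence : Word k → Word n → Pred (Vec (Fin n) k) _
IsOccurrence τ π is =
  Increasing is ×
  (∀ a b → lookup π (lookup is a) < lookup π (lookup is b) ⇔ lookup τ a < lookup τ b)

Avoids : Word k → Pred (Word n) _
Avoids τ π = ¬ ∃ (IsOccurrence τ π)

_⇔-dec_ : Dec A → Dec B → Dec (A ⇔ B)
a? ⇔-dec b? =
  map′ (λ (f , g) → mk⇔ f g) (λ e → Equivalence.to e , Equivalence.from e)
       ((a? →-dec b?) ×-dec (b? →-dec a?))

anyVec? : {P : Pred (Vec (Fin n) k) ℓ} → Decidable P → Dec (∃ P)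
anyVec? {k = zero}  P? = map′ ([] ,_) (λ { ([] , p) → p }) (P? [])
anyVec? {k = suc k} P? =
  map′ (λ (i , is , p) → i ∷ is , p) (λ { (i ∷ is , p) → i , is , p })
       (any? λ i → anyVec? λ is → P? (i ∷ is))

isOccurrence? : (τ : Word k) (π : Word n) → Decidable (IsOccurrence τ π)
isOccurrence? τ π is =
  (all? λ a → all? λ b → (a <? b) →-dec (lookup is a <? lookup is b)) ×-dec
  (all? λ a → all? λ b →
     (lookup π (lookup is a) <? lookup π (lookup is b)) ⇔-dec (lookup τ a <? lookup τ b))

avoids? : (τ : Word k) → Decidable (Avoids {n = n} τ)
avoids? τ π = ¬? (anyVec? (isOccurrence? τ π))

-- Sₙ(τ,ρ), each element listed once.
S : ∀ {k l} n → Word k → Word l → List (Word n)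
S n τ ρ = filter (λ π → isPermutation? π ×-dec avoids? τ π ×-dec avoids? ρ π) (vectors n n)

-- The patterns 213 and 231, shifted to start at 0.
[213] [231] : Word 3
[213] = 1F ∷ 0F ∷ 2F ∷ []
[231] = 1F ∷ 2F ∷ 0F ∷ []

------------------------------------------------------------------------
-- Statistics

module _ (π : Word n) where

  IsAscent IsDescent IsLRMax IsLRMin IsRLMax IsRLMin : Pred (Fin n) _
  IsAscent  i = ∃ λ j → toℕ j ≡ suc (toℕ i) × lookup π i < lookup π j
  IsDescent i = ∃ λ j → toℕ j ≡ suc (toℕ i) × lookup π j < lookup π i
  IsLRMax   i = ∀ j → j < i → lookup π j < lookup π i
  IsLRMin   i = ∀ j → j < i → lookup π i < lookup π j
  IsRLMax   i = ∀ j → i < j → lookup π j < lookup π i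
  IsRLMin   i = ∀ j → i < j → lookup π i < lookup π j

  isAscent? : Decidable IsAscent
  isAscent? i = any? λ j → (toℕ j ℕ.≟ suc (toℕ i)) ×-dec (lookup π i <? lookup π j)

  isDescent? : Decidable IsDescent
  isDescent? i = any? λ j → (toℕ j ℕ.≟ suc (toℕ i)) ×-dec (lookup π j <? lookup π i)

  isLRMax? : Decidable IsLRMax
  isLRMax? i = all? λ j → (j <? i) →-dec (lookup π j <? lookup π i)

  isLRMin? : Decidable IsLRMin
  isLRMin? i = all? λ j → (j <? i) →-dec (lookup π i <? lookup π j)

  isRLMax? : Decidable IsRLMax
  isRLMax? i = all? λ j → (i <? j) →-dec (lookup π j <? lookup π i)

  isRLMin? : Decidable IsRLMin
  isRLMin? i = all? λ j → (i <? j) →-dec (lookup π i <? lookup π j)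

count : {P : Pred (Fin n) ℓ} → Decidable P → ℕ
count {n = n} P? = length (filter P? (allFin n))

asc des lrmax rlmax lrmin rlmin : Word n → ℕ
asc   = count ∘ isAscent?
des   = count ∘ isDescent?
lrmax = count ∘ isLRMax?
rlmax = count ∘ isRLMax?
lrmin = count ∘ isLRMin?
rlmin = count ∘ isRLMin?

------------------------------------------------------------------------
-- Formal power series in x over a commutative ring

module PowerSeries {c ℓ} (R : CommutativeRing c ℓ) where

  open CommutativeRing R
  open Sum semiring using (sum)

  -- f n is the coefficient of xⁿ.
  Series : Set c
  Series = ℕ → Carrier

  infix  4 _≈ˢ_
  infixl 7 _*ˢ_

  _≈ˢ_ : Series → Series → Set ℓ
  f ≈ˢ g = ∀ n → f n ≈ g n

  _*ˢ_ : Series → Series → Series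
  (f *ˢ g) n = sum λ (i : Fin (suc n)) → f (toℕ i) * g (n ∸ toℕ i)

  -- The polynomial c₀ + c₁x + c₂x² + ⋯ with the given list of coefficients.
  poly : List Carrier → Series
  poly []       _       = 0#
  poly (c ∷ cs) zero    = c
  poly (c ∷ cs) (suc n) = poly cs n

  1ˢ : Series
  1ˢ = poly (1# ∷ [])

  -- f = g / h: the series h is invertible and f = g h⁻¹.
  IsQuotient : Series → Series → Series → Set _
  IsQuotient f g h = ∃ λ h⁻¹ → h *ˢ h⁻¹ ≈ˢ 1ˢ × f ≈ˢ g *ˢ h⁻¹

------------------------------------------------------------------------
-- The generating function, as a power series in x

-- The coefficients are taken in an arbitrary commutative ring containing
-- p, …, t; the polynomial ring ℤ[p,q,u,v,s,t] is the universal instance.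
module GeneratingFunction {c ℓ} (R : CommutativeRing c ℓ)
                          (p q u v s t : CommutativeRing.Carrier R) where

  open CommutativeRing R
  open Exp semiring using (_^_)
  open PowerSeries R

  weight : Word n → Carrier
  weight π = p ^ asc π * q ^ des π * u ^ lrmax π * v ^ rlmax π * s ^ lrmin π * t ^ rlmin π

  F : ∀ {k l} → Word k → Word l → Series
  F τ ρ n = List.foldr _+_ 0# (List.map weight (S n τ ρ))

{-# OPTIONS --safe #-}
-- A permutation avoids 213 and 231 exactly when every letter is the minimum or the
-- maximum of the suffix it starts. Hence, for n ≥ 1, the avoiders of length n + 1
-- arise from those of length n by prepending a new minimum or a new maximum. A new
-- minimum increases asc, lrmax and rlmin by one and makes lrmin equal to 1; a new
-- maximum acts symmetrically. Writing F u s for the generating function, its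
-- coefficients therefore satisfy, for n ≥ 1,
--   F u s (n + 1) = p t u s · F u 1 n + q v u s · F 1 s n,
-- which is solved first for F 1 1, then for F u 1 and F 1 s, and finally for F u s.
module Submission where

open import Defs
open import Algebra.Bundles using (CommutativeRing; RawRing)
import Algebra.Properties.AbelianGroup as AbelianGroupProperties
import Algebra.Properties.CommutativeSemigroup as CommutativeSemigroupProperties
import Algebra.Properties.Ring as RingProperties
import Algebra.Properties.Semiring.Exp as Exp
import Algebra.Properties.Semiring.Mult as Mult
import Algebra.Properties.Semiring.Mult.TCOptimised as TCMult
import Algebra.Properties.Semiring.Sum as Sum
import Algebra.Solver.Ring as Solver
open import Algebra.Solver.Ring.AlmostCommutativeRing
  using (fromCommutativeRing; _-Raw-AlmostCommutative⟶_; Induced-equivalence)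
open import Data.Empty using (⊥)
open import Data.Fin.Base using (Fin; zero; suc; fromℕ; punchIn; punchOut; toℕ; _<_)
open import Data.Fin.Patterns using (0F; 1F; 2F)
import Data.Fin.Properties as Fin
open import Data.List.Base as List using (List; []; _∷_; _++_; allFin; filter; length)
import Data.List.Properties as List
open import Data.List.Membership.Propositional using (_∈_)
open import Data.List.Membership.Propositional.Properties
  using (∈-map⁺; ∈-map⁻; ∈-++⁺ˡ; ∈-++⁺ʳ; ∈-++⁻; ∈-allFin; ∈-cartesianProductWith⁺; ∈-filter⁺; ∈-filter⁻)
open import Data.List.Membership.Propositional.Properties.WithK using (unique∧set⇒bag)
open import Data.List.Relation.Binary.BagAndSetEquality using (∼bag⇒↭)
open import Data.List.Relation.Binary.Permutation.Propositional as ↭ using (_↭_)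
open import Data.List.Relation.Unary.Any using (here)
import Data.List.Relation.Unary.Unique.Propositional as List
import Data.List.Relation.Unary.Unique.Propositional.Properties as List
import Data.List.Relation.Unary.AllPairs as ListAllPairs
import Data.List.Relation.Unary.All as ListAll
open import Data.Maybe.Base using (just; nothing)
open import Data.Nat.Base as ℕ using (ℕ; zero; suc; s<s; s<s⁻¹; z<s)
import Data.Nat.Properties as ℕ
open import Data.Product.Base using (∃; _×_; _,_; proj₁; proj₂)
open import Data.Sum.Base using (_⊎_; inj₁; inj₂)
open import Data.Vec.Base as Vec using (Vec; []; _∷_; lookup)
import Data.Vec.Properties as Vec
open import Data.Vec.Relation.Unary.All as All using (All; []; _∷_)
import Data.Vec.Relation.Unary.All.Properties as All
open import Data.Vec.Relation.Unary.AllPairs using ([]; _∷_)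
open import Data.Vec.Relation.Unary.Unique.Propositional using (Unique)
import Data.Vec.Relation.Unary.Unique.Propositional.Properties as Unique
open import Function.Base using (_∘_; _$_)
open import Function.Bundles using (_⇔_; mk⇔; Equivalence)
open import Level using (Level; 0ℓ)
open import Relation.Binary.Definitions using (WeaklyDecidable; tri<; tri≈; tri>)
open import Relation.Binary.PropositionalEquality as ≡ using (_≡_; _≢_; cong; cong₂; subst)
import Relation.Binary.Reasoning.Setoid as SetoidReasoning
open import Relation.Nullary.Decidable using (yes; no; toWitness)
open import Relation.Nullary.Negation using (¬_; contradiction)
open import Relation.Unary using (Pred; Decidable)

private
  variable
    ℓ ℓ′ : Level
    k n : ℕ

-- Counting positions by splitting off the first one

module _ {P : Pred (Fin (suc n)) ℓ} (P? : Decidable P) where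

  private
    filter-map-suc : ∀ is → length (filter P? (List.map suc is)) ≡ length (filter (P? ∘ suc) is)
    filter-map-suc []       = ≡.refl
    filter-map-suc (i ∷ is) with P? (suc i)
    ... | yes _ = cong suc (filter-map-suc is)
    ... | no  _ = filter-map-suc is

    count-tail : length (filter P? (List.tabulate suc)) ≡ count (P? ∘ suc)
    count-tail = ≡.trans (cong (length ∘ filter P?) (≡.sym (List.map-tabulate (λ i → i) suc)))
                         (filter-map-suc (allFin n))

  module _ {Q : Pred (Fin n) ℓ′} (Q? : Decidable Q) (P∘suc⇔Q : ∀ i → P (suc i) ⇔ Q i) where

    private
      count-∘suc : count (P? ∘ suc) ≡ count Q?
      count-∘suc = cong length $ List.filter-≐ (P? ∘ suc) Q?
        ((λ {i} → Equivalence.to (P∘suc⇔Q i)) , (λ {i} → Equivalence.from (P∘suc⇔Q i))) (allFin n)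

    count-accept : P zero → count P? ≡ suc (count Q?)
    count-accept p =
      ≡.trans (cong length (List.filter-accept P? p)) (cong suc (≡.trans count-tail count-∘suc))

    count-reject : ¬ P zero → count P? ≡ count Q?
    count-reject ¬p = ≡.trans (cong length (List.filter-reject P? ¬p)) (≡.trans count-tail count-∘suc)

  count-first : P zero → (∀ i → ¬ P (suc i)) → count P? ≡ 1
  count-first p ¬P∘suc = ≡.trans (cong length (List.filter-accept P? p)) (cong suc (≡.trans count-tail
    (cong length (List.filter-none (P? ∘ suc) (ListAll.universal ¬P∘suc (allFin n))))))

-- Prepending a letter and its effect on the statistics

punchIn-mono-< : (c : Fin (suc n)) {x y : Fin n} → x < y → punchIn c x < punchIn c y
punchIn-mono-< c x<y = ℕ.≰⇒> (ℕ.<⇒≱ x<y ∘ Fin.punchIn-cancel-≤ c _ _)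

punchIn-cancel-< : (c : Fin (suc n)) {x y : Fin n} → punchIn c x < punchIn c y → x < y
punchIn-cancel-< c px<py = ℕ.≰⇒> (ℕ.<⇒≱ px<py ∘ Fin.punchIn-mono-≤ c _ _)

-- `punchIn c` raises the letters from `c` upwards by one, which frees the value `c` and keeps the
-- relative order of `π`.
prepend : Fin (suc n) → Word n → Word (suc n)
prepend c π = c ∷ Vec.map (punchIn c) π

AllAbove AllBelow : Fin (suc n) → Word n → Set
AllAbove c π = ∀ i → c < lookup (prepend c π) (suc i)
AllBelow c π = ∀ i → lookup (prepend c π) (suc i) < c

module _ (c : Fin (suc n)) (π : Word n) where

  private
    π⁺ = prepend c π

  -- Since `punchIn c` preserves and reflects the strict order, every comparison inside the tail can
  -- be carried out in `π`; the lemmas on the single statistics rest on this.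
  tail-< : ∀ i j → lookup π⁺ (suc i) < lookup π⁺ (suc j) ⇔ lookup π i < lookup π j
  tail-< i j rewrite Vec.lookup-map i (punchIn c) π | Vec.lookup-map j (punchIn c) π =
    mk⇔ (punchIn-cancel-< c) (punchIn-mono-< c)

  private
    module Tail i j = Equivalence (tail-< i j)

  isAscent-tail : ∀ i → IsAscent π⁺ (suc i) ⇔ IsAscent π i
  isAscent-tail i = mk⇔
    (λ { (suc j , j≡1+i , πi<πj) → j , ℕ.suc-injective j≡1+i , Tail.to i j πi<πj })
    (λ { (j , j≡1+i , πi<πj) → suc j , cong suc j≡1+i , Tail.from i j πi<πj })

  isDescent-tail : ∀ i → IsDescent π⁺ (suc i) ⇔ IsDescent π i
  isDescent-tail i = mk⇔
    (λ { (suc j , j≡1+i , πj<πi) → j , ℕ.suc-injective j≡1+i , Tail.to j i πj<πi })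
    (λ { (j , j≡1+i , πj<πi) → suc j , cong suc j≡1+i , Tail.from j i πj<πi })

  isRLMax-tail : ∀ i → IsRLMax π⁺ (suc i) ⇔ IsRLMax π i
  isRLMax-tail i = mk⇔
    (λ max j i<j → Tail.to j i (max (suc j) (s<s i<j)))
    (λ { max (suc j) i<j → Tail.from j i (max j (s<s⁻¹ i<j)) })

  isRLMin-tail : ∀ i → IsRLMin π⁺ (suc i) ⇔ IsRLMin π i
  isRLMin-tail i = mk⇔
    (λ min j i<j → Tail.to i j (min (suc j) (s<s i<j)))
    (λ { min (suc j) i<j → Tail.from i j (min j (s<s⁻¹ i<j)) })

  -- Being a left-to-right maximum looks back at the new first letter too, and `above` makes that
  -- extra condition true.
  isLRMax-tail : AllAbove c π → ∀ i → IsLRMax π⁺ (suc i) ⇔ IsLRMax π i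
  isLRMax-tail above i = mk⇔
    (λ max j j<i → Tail.to j i (max (suc j) (s<s j<i)))
    (λ { max zero _ → above i ; max (suc j) j<i → Tail.from j i (max j (s<s⁻¹ j<i)) })

  isLRMin-tail : AllBelow c π → ∀ i → IsLRMin π⁺ (suc i) ⇔ IsLRMin π i
  isLRMin-tail below i = mk⇔
    (λ min j j<i → Tail.to i j (min (suc j) (s<s j<i)))
    (λ { min zero _ → below i ; min (suc j) j<i → Tail.from i j (min j (s<s⁻¹ j<i)) })

  lrmax-prepend-above : AllAbove c π → lrmax π⁺ ≡ suc (lrmax π)
  lrmax-prepend-above above =
    count-accept (isLRMax? π⁺) (isLRMax? π) (isLRMax-tail above) (λ _ ())

  lrmin-prepend-below : AllBelow c π → lrmin π⁺ ≡ suc (lrmin π)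
  lrmin-prepend-below below =
    count-accept (isLRMin? π⁺) (isLRMin? π) (isLRMin-tail below) (λ _ ())

  lrmax-prepend-below : AllBelow c π → lrmax π⁺ ≡ 1
  lrmax-prepend-below below =
    count-first (isLRMax? π⁺) (λ _ ()) (λ i max → ℕ.<-asym (max zero z<s) (below i))

  lrmin-prepend-above : AllAbove c π → lrmin π⁺ ≡ 1
  lrmin-prepend-above above =
    count-first (isLRMin? π⁺) (λ _ ()) (λ i min → ℕ.<-asym (min zero z<s) (above i))

  rlmin-prepend-above : AllAbove c π → rlmin π⁺ ≡ suc (rlmin π)
  rlmin-prepend-above above =
    count-accept (isRLMin? π⁺) (isRLMin? π) isRLMin-tail (λ { (suc j) _ → above j })

  rlmax-prepend-below : AllBelow c π → rlmax π⁺ ≡ suc (rlmax π)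
  rlmax-prepend-below below =
    count-accept (isRLMax? π⁺) (isRLMax? π) isRLMax-tail (λ { (suc j) _ → below j })

module _ (c : Fin (suc (suc n))) (π : Word (suc n)) where

  private
    π⁺ = prepend c π

  -- The pair formed by `c` and the first letter of `π` is the new ascent. This needs a nonempty
  -- `π`, as do the neighbouring lemmas: `c` fails to be a right-to-left maximum, for instance, only
  -- because a larger letter follows.
  asc-prepend-above : AllAbove c π → asc π⁺ ≡ suc (asc π)
  asc-prepend-above above =
    count-accept (isAscent? π⁺) (isAscent? π) (isAscent-tail c π) (1F , ≡.refl , above 0F)

  des-prepend-below : AllBelow c π → des π⁺ ≡ suc (des π)
  des-prepend-below below =
    count-accept (isDescent? π⁺) (isDescent? π) (isDescent-tail c π) (1F , ≡.refl , below 0F)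

  asc-prepend-below : AllBelow c π → asc π⁺ ≡ asc π
  asc-prepend-below below =
    count-reject (isAscent? π⁺) (isAscent? π) (isAscent-tail c π)
      (λ { (suc j , _ , c<πj) → ℕ.<-asym c<πj (below j) })

  des-prepend-above : AllAbove c π → des π⁺ ≡ des π
  des-prepend-above above =
    count-reject (isDescent? π⁺) (isDescent? π) (isDescent-tail c π)
      (λ { (suc j , _ , πj<c) → ℕ.<-asym πj<c (above j) })

  rlmax-prepend-above : AllAbove c π → rlmax π⁺ ≡ rlmax π
  rlmax-prepend-above above =
    count-reject (isRLMax? π⁺) (isRLMax? π) (isRLMax-tail c π) (λ max → ℕ.<-asym (max 1F z<s) (above 0F))

  rlmin-prepend-below : AllBelow c π → rlmin π⁺ ≡ rlmin π
  rlmin-prepend-below below =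
    count-reject (isRLMin? π⁺) (isRLMin? π) (isRLMin-tail c π) (λ min → ℕ.<-asym (min 1F z<s) (below 0F))

prependMin prependMax : Word n → Word (suc n)
prependMin         = prepend zero
prependMax {n = n} = prepend (fromℕ n)

prependMin-above : (π : Word n) → AllAbove zero π
prependMin-above {n} π i = subst (zero {n} <_) (≡.sym (Vec.lookup-map i (punchIn zero) π)) z<s

prependMax-below : (π : Word n) → AllBelow (fromℕ n) π
prependMax-below {n = n} π i rewrite Vec.lookup-map i (punchIn (fromℕ n)) π =
  Fin.≤∧≢⇒< (Fin.≤fromℕ _) (Fin.punchInᵢ≢i (fromℕ n) (lookup π i))

-- Avoidance of 213 and 231 as a condition on middle letters

-- For permutations this is joint avoidance of 213 and 231: no letter has both a
-- smaller and a larger letter to its right.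
NoMiddle : Pred (Word n) 0ℓ
NoMiddle π = ∀ i j k → i < j → i < k → lookup π j < lookup π i → lookup π i < lookup π k → ⊥

private
  unique[213] : IsPermutation [213]
  unique[213] = toWitness {a? = isPermutation? [213]} _

  unique[231] : IsPermutation [231]
  unique[231] = toWitness {a? = isPermutation? [231]} _

-- Preserving the order of `τ` suffices: the letters of `τ` are distinct, so by trichotomy a failure
-- to reflect the order would contradict preservation for the reversed pair.
isOccurrence : (τ : Word k) (π : Word n) (is : Vec (Fin n) k) → IsPermutation τ → Increasing is →
               (∀ a b → lookup τ a < lookup τ b → lookup π (lookup is a) < lookup π (lookup is b)) →
               IsOccurrence τ π is
isOccurrence τ π is τ! is↑ mono = is↑ , λ a b → mk⇔ (reflect a b) (mono a b)
  where
  reflect : ∀ a b → lookup π (lookup is a) < lookup π (lookup is b) → lookup τ a < lookup τ b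
  reflect a b πa<πb with Fin.<-cmp (lookup τ a) (lookup τ b)
  ... | tri< τa<τb _ _ = τa<τb
  ... | tri≈ _ τa≡τb _ with ≡.refl ← Unique.lookup-injective τ! a b τa≡τb =
    contradiction πa<πb (ℕ.<-irrefl ≡.refl)
  ... | tri> _ _ τb<τa = contradiction (mono b a τb<τa) (ℕ.<-asym πa<πb)

increasing : {i j k : Fin n} → i < j → j < k → Increasing (i ∷ j ∷ k ∷ [])
increasing i<j j<k 0F 1F _ = i<j
increasing i<j j<k 0F 2F _ = ℕ.<-trans i<j j<k
increasing i<j j<k 1F 2F _ = j<k
increasing i<j j<k 1F 1F (s<s ())
increasing i<j j<k 2F 1F (s<s ())
increasing i<j j<k 2F 2F (s<s (s<s ()))

-- The letter at `i` plays the middle value of the pattern. Whether the smaller letter comes before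
-- or after the larger one decides between 213 and 231.
avoids⇒noMiddle : {π : Word n} → Avoids [213] π → Avoids [231] π → NoMiddle π
avoids⇒noMiddle {π = π} av213 av231 i j k i<j i<k πj<πi πi<πk with Fin.<-cmp j k
... | tri< j<k _ _ =
  av213 (i ∷ j ∷ k ∷ [] , isOccurrence [213] π (i ∷ j ∷ k ∷ []) unique[213] (increasing i<j j<k) mono)
  where
  mono : ∀ a b → lookup [213] a < lookup [213] b →
         lookup π (lookup (i ∷ j ∷ k ∷ []) a) < lookup π (lookup (i ∷ j ∷ k ∷ []) b)
  mono 0F 0F (s<s ())
  mono 0F 2F _ = πi<πk
  mono 1F 0F _ = πj<πi
  mono 1F 2F _ = ℕ.<-trans πj<πi πi<πk
  mono 2F 0F (s<s ())
  mono 2F 2F (s<s (s<s ()))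
... | tri≈ _ ≡.refl _ = ℕ.<-asym πj<πi πi<πk
... | tri> _ _ k<j =
  av231 (i ∷ k ∷ j ∷ [] , isOccurrence [231] π (i ∷ k ∷ j ∷ []) unique[231] (increasing i<k k<j) mono)
  where
  mono : ∀ a b → lookup [231] a < lookup [231] b →
         lookup π (lookup (i ∷ k ∷ j ∷ []) a) < lookup π (lookup (i ∷ k ∷ j ∷ []) b)
  mono 0F 0F (s<s ())
  mono 0F 1F _ = πi<πk
  mono _  2F ()
  mono 1F 0F (s<s ())
  mono 1F 1F (s<s (s<s ()))
  mono 2F 0F _ = πj<πi
  mono 2F 1F _ = ℕ.<-trans πj<πi πi<πk

noMiddle⇒avoids[213] : {π : Word n} → NoMiddle π → Avoids [213] π
noMiddle⇒avoids[213] noMid (i ∷ j ∷ k ∷ [] , is↑ , iso) =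
  noMid i j k (is↑ 0F 1F z<s) (is↑ 0F 2F z<s)
    (Equivalence.from (iso 1F 0F) z<s) (Equivalence.from (iso 0F 2F) (s<s z<s))

noMiddle⇒avoids[231] : {π : Word n} → NoMiddle π → Avoids [231] π
noMiddle⇒avoids[231] noMid (i ∷ j ∷ k ∷ [] , is↑ , iso) =
  noMid i k j (is↑ 0F 2F z<s) (is↑ 0F 1F z<s)
    (Equivalence.from (iso 2F 0F) z<s) (Equivalence.from (iso 0F 1F) (s<s z<s))

noMiddle-tail : (c : Fin (suc n)) (π : Word n) → NoMiddle (prepend c π) → NoMiddle π
noMiddle-tail c π noMid i j k i<j i<k πj<πi πi<πk =
  noMid (suc i) (suc j) (suc k) (s<s i<j) (s<s i<k)
    (Equivalence.from (tail-< c π j i) πj<πi) (Equivalence.from (tail-< c π i k) πi<πk)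

-- The only new candidate for a middle letter is `c`, and all later letters lie on one side of it.
noMiddle-prepend : (c : Fin (suc n)) (π : Word n) → AllAbove c π ⊎ AllBelow c π → NoMiddle π →
                   NoMiddle (prepend c π)
noMiddle-prepend c π (inj₁ above) noMid zero (suc j) (suc k) _ _ πj<c c<πk = ℕ.<-asym πj<c (above j)
noMiddle-prepend c π (inj₂ below) noMid zero (suc j) (suc k) _ _ πj<c c<πk = ℕ.<-asym c<πk (below k)
noMiddle-prepend c π _ noMid (suc i) (suc j) (suc k) i<j i<k πj<πi πi<πk =
  noMid i j k (s<s⁻¹ i<j) (s<s⁻¹ i<k)
    (Equivalence.to (tail-< c π j i) πj<πi) (Equivalence.to (tail-< c π i k) πi<πk)

-- Splitting a permutation into its first letter and the rest

unique-map⁻ : {A : Set ℓ} {B : Set ℓ′} (f : A → B) (xs : Vec A n) → Unique (Vec.map f xs) → Unique xs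
unique-map⁻ f []       []           = []
unique-map⁻ f (x ∷ xs) (fx∉ ∷ fxs!) = All.map (_∘ cong f) (All.map⁻ fx∉) ∷ unique-map⁻ f xs fxs!

-- The image of `punchIn c` consists of all letters except `c`, and `punchOut` inverts it there.
unpunch : (c : Fin (suc n)) (xs : Vec (Fin (suc n)) k) → All (c ≢_) xs → ∃ λ ys → xs ≡ Vec.map (punchIn c) ys
unpunch c []       []           = [] , ≡.refl
unpunch c (x ∷ xs) (c≢x ∷ c∉xs) =
  let ys , xs≡ys = unpunch c xs c∉xs
  in punchOut c≢x ∷ ys , cong₂ _∷_ (≡.sym (Fin.punchIn-punchOut c≢x)) xs≡ys

isPermutation-prepend : (c : Fin (suc n)) (π : Word n) → IsPermutation π → IsPermutation (prepend c π)
isPermutation-prepend c π π! =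
  All.map⁺ (All.universal (λ x c≡x → Fin.punchInᵢ≢i c x (≡.sym c≡x)) π) ∷
  Unique.map⁺ (λ {x} {y} → Fin.punchIn-injective c x y) π!

data Prepended : Word (suc n) → Set where
  prepended : (c : Fin (suc n)) (π : Word n) → IsPermutation π → Prepended (prepend c π)

uncons : (π : Word (suc n)) → IsPermutation π → Prepended π
uncons (c ∷ xs) (c∉xs ∷ xs!) with π , ≡.refl ← unpunch c xs c∉xs =
  prepended c π (unique-map⁻ (punchIn c) π xs!)

-- Pigeonhole: if `x` were missed, `punchOut` would turn `π` into an injection into a set with one
-- element fewer.
isPermutation⇒surjective : (π : Word n) → IsPermutation π → ∀ x → ∃ λ i → lookup π i ≡ x
isPermutation⇒surjective {suc n} π π! x with Fin.any? (λ i → lookup π i Fin.≟ x)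
... | yes x∈π = x∈π
... | no  x∉π = contradiction
  (Fin.injective⇒≤ {f = λ i → punchOut (x≢ i)}
    (λ {i} {j} eq → Unique.lookup-injective π! i j (Fin.punchOut-injective (x≢ i) (x≢ j) eq)))
  (ℕ.<⇒≱ ℕ.≤-refl)
  where
  x≢ : ∀ i → x ≢ lookup π i
  x≢ i x≡πi = x∉π (i , ≡.sym x≡πi)

-- If `c` were neither the least nor the greatest value, both of these would occur in the tail by
-- surjectivity, and `c` would be a middle letter.
noMiddle⇒extreme : (c : Fin (suc (suc n))) (π : Word (suc n)) → IsPermutation π → NoMiddle (prepend c π) →
                   c ≡ zero ⊎ c ≡ fromℕ (suc n)
noMiddle⇒extreme zero _ _ _ = inj₁ ≡.refl
noMiddle⇒extreme {n} c@(suc _) π π! noMid with c Fin.≟ fromℕ (suc n)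
... | yes c≡max = inj₂ c≡max
... | no  c≢max = contradiction (noMid zero (suc i) (suc j) z<s z<s πi<c c<πj) λ ()
  where
  c<max : c < fromℕ (suc n)
  c<max = Fin.≤∧≢⇒< (Fin.≤fromℕ c) c≢max

  letter : ∀ x → c ≢ x → ∃ λ i → lookup (prepend c π) (suc i) ≡ x
  letter x c≢x = let i , πi≡ = isPermutation⇒surjective π π! (punchOut c≢x) in
    i , ≡.trans (Vec.lookup-map i (punchIn c) π) (≡.trans (cong (punchIn c) πi≡) (Fin.punchIn-punchOut c≢x))

  i j : Fin (suc n)
  i = proj₁ (letter zero λ ())
  j = proj₁ (letter (fromℕ (suc n)) c≢max)

  πi<c : lookup (prepend c π) (suc i) < c
  πi<c = subst (_< c) (≡.sym (proj₂ (letter zero λ ()))) z<s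

  c<πj : c < lookup (prepend c π) (suc j)
  c<πj = subst (c <_) (≡.sym (proj₂ (letter (fromℕ (suc n)) c≢max))) c<max

-- Enumeration of the avoiders

∈-vectors : (xs : Vec (Fin n) k) → xs ∈ vectors n k
∈-vectors []       = here ≡.refl
∈-vectors (x ∷ xs) = ∈-cartesianProductWith⁺ _∷_ (∈-allFin x) (∈-vectors xs)

vectors-unique : ∀ n k → List.Unique (vectors n k)
vectors-unique n zero    = ListAll.[] ListAllPairs.∷ ListAllPairs.[]
vectors-unique n (suc k) =
  List.cartesianProductWith⁺ _∷_ Vec.∷-injective (List.allFin⁺ n) (vectors-unique n k)

S-unique : ∀ n → List.Unique (S n [213] [231])
S-unique n = List.filter⁺ _ (vectors-unique n n)

IsAvoider : Pred (Word n) 0ℓ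
IsAvoider π = IsPermutation π × NoMiddle π

∈-S⁺ : (π : Word n) → IsAvoider π → π ∈ S n [213] [231]
∈-S⁺ π (π! , noMid) =
  ∈-filter⁺ _ (∈-vectors π) (π! , noMiddle⇒avoids[213] {π = π} noMid , noMiddle⇒avoids[231] {π = π} noMid)

∈-S⁻ : (π : Word n) → π ∈ S n [213] [231] → IsAvoider π
∈-S⁻ {n} π π∈S = let _ , π! , av213 , av231 = ∈-filter⁻ _ {xs = vectors n n} π∈S in
  π! , avoids⇒noMiddle {π = π} av213 av231

map-injective : {A : Set ℓ} {B : Set ℓ′} {f : A → B} → (∀ {x y} → f x ≡ f y → x ≡ y) →
                {xs ys : Vec A n} → Vec.map f xs ≡ Vec.map f ys → xs ≡ ys
map-injective f-inj {[]}     {[]}     _  = ≡.refl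
map-injective f-inj {x ∷ xs} {y ∷ ys} eq =
  cong₂ _∷_ (f-inj (Vec.∷-injectiveˡ eq)) (map-injective f-inj (Vec.∷-injectiveʳ eq))

prepend-injective : (c : Fin (suc n)) {π ρ : Word n} → prepend c π ≡ prepend c ρ → π ≡ ρ
prepend-injective c eq = map-injective (Fin.punchIn-injective c _ _) (Vec.∷-injectiveʳ eq)

module _ {πs : List (Word (suc (suc n)))} {ρs : List (Word (suc n))}
         (πs! : List.Unique πs) (ρs! : List.Unique ρs)
         (∈-πs⇔ : ∀ π → π ∈ πs ⇔ IsAvoider π) (∈-ρs⇔ : ∀ ρ → ρ ∈ ρs ⇔ IsAvoider ρ) where

  private
    extensions = List.map prependMin ρs ++ List.map prependMax ρs

    extensions! : List.Unique extensions
    extensions! = List.++⁺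
      (List.map⁺ (prepend-injective zero) ρs!)
      (List.map⁺ (prepend-injective (fromℕ (suc n))) ρs!)
      -- The two kinds of extension differ in their first letter, `zero` against `fromℕ (suc n)`. At
      -- length one both would give the same word, so the recurrence starts at length two.
      λ (π∈min , π∈max) →
        let _ , _ , π≡min = ∈-map⁻ prependMin π∈min
            _ , _ , π≡max = ∈-map⁻ prependMax π∈max
        in contradiction (Vec.∷-injectiveˡ (≡.trans (≡.sym π≡min) π≡max)) λ ()

    avoider⇒extension : ∀ π → IsAvoider π → π ∈ extensions
    avoider⇒extension π (π! , noMid) with uncons π π!
    ... | prepended c ρ ρ!
      with ρ∈ρs ← Equivalence.from (∈-ρs⇔ ρ) (ρ! , noMiddle-tail c ρ noMid)
         | noMiddle⇒extreme c ρ ρ! noMid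
    ...   | inj₁ ≡.refl = ∈-++⁺ˡ (∈-map⁺ prependMin ρ∈ρs)
    ...   | inj₂ ≡.refl = ∈-++⁺ʳ _ (∈-map⁺ prependMax ρ∈ρs)

    extension⇒avoider : ∀ π → π ∈ extensions → IsAvoider π
    extension⇒avoider π π∈ with ∈-++⁻ (List.map prependMin ρs) π∈
    ... | inj₁ π∈min
      with ρ , ρ∈ρs , ≡.refl ← ∈-map⁻ prependMin π∈min
      with ρ! , noMid ← Equivalence.to (∈-ρs⇔ ρ) ρ∈ρs =
      isPermutation-prepend _ ρ ρ! , noMiddle-prepend _ ρ (inj₁ (prependMin-above ρ)) noMid
    ... | inj₂ π∈max
      with ρ , ρ∈ρs , ≡.refl ← ∈-map⁻ prependMax π∈max
      with ρ! , noMid ← Equivalence.to (∈-ρs⇔ ρ) ρ∈ρs =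
      isPermutation-prepend _ ρ ρ! , noMiddle-prepend _ ρ (inj₂ (prependMax-below ρ)) noMid

  -- Two lists without repetition and with the same members are rearrangements of each other.
  avoiders-↭ : πs ↭ extensions
  avoiders-↭ = ∼bag⇒↭ (unique∧set⇒bag πs! extensions! λ {π} → mk⇔
    (avoider⇒extension π ∘ Equivalence.to (∈-πs⇔ π))
    (Equivalence.from (∈-πs⇔ π) ∘ extension⇒avoider π))

S-suc-↭ : ∀ n → S (suc (suc n)) [213] [231] ↭
                List.map prependMin (S (suc n) [213] [231]) ++ List.map prependMax (S (suc n) [213] [231])
S-suc-↭ n = avoiders-↭ (S-unique (suc (suc n))) (S-unique (suc n))
  (λ π → mk⇔ (∈-S⁻ π) (∈-S⁺ π)) (λ ρ → mk⇔ (∈-S⁻ ρ) (∈-S⁺ ρ))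

-- A ring solver with integer coefficients

-- The pair (m , n) stands for the integer m − n.
differences : RawRing _ _
differences = record
  { Carrier = ℕ × ℕ
  ; _≈_ = λ (m , n) (m′ , n′) → m ℕ.+ n′ ≡ m′ ℕ.+ n
  ; _+_ = λ (m , n) (m′ , n′) → m ℕ.+ m′ , n ℕ.+ n′
  ; _*_ = λ (m , n) (m′ , n′) → m ℕ.* m′ ℕ.+ n ℕ.* n′ , m ℕ.* n′ ℕ.+ n ℕ.* m′
  ; -_ = λ (m , n) → n , m
  ; 0# = 0 , 0
  ; 1# = 1 , 0
  }

module IntegerSolver {c ℓ} (R : CommutativeRing c ℓ) where
  open CommutativeRing R hiding (zero)
  private module ℤ = RawRing differences
  open Mult semiring using (×-homo-+; ×1-homo-*; ×-homo-1) renaming (_×_ to _·_)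
  open TCMult semiring using (×ᵤ≈×) renaming (_×_ to _·′_)
  open AbelianGroupProperties +-abelianGroup using (⁻¹-∙-comm; ⁻¹-anti-homo‿-; x≈z//y; ε⁻¹≈ε)
  open CommutativeSemigroupProperties +-commutativeSemigroup using (interchange)
  open RingProperties ring using (-‿distribˡ-*; -‿distribʳ-*; -‿involutive)
  open SetoidReasoning setoid

  embed : ℕ × ℕ → Carrier
  embed (m , n) = m · 1# - n · 1#

  +-interchange : ∀ x y z w → (x + z) - (y + w) ≈ (x - y) + (z - w)
  +-interchange x y z w =
    trans (+-congˡ (sym (⁻¹-∙-comm y w))) (interchange x z (- y) (- w))

  embed-+ : ∀ i j → embed (i ℤ.+ j) ≈ embed i + embed j
  embed-+ (m , n) (m′ , n′) =
    trans (+-cong (×-homo-+ 1# m m′) (-‿cong (×-homo-+ 1# n n′))) (+-interchange _ _ _ _)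

  neg-*-neg : ∀ x y → - x * - y ≈ x * y
  neg-*-neg x y = begin
    - x * - y     ≈⟨ -‿distribˡ-* x (- y) ⟨
    - (x * - y)   ≈⟨ -‿cong (-‿distribʳ-* x y) ⟨
    - - (x * y)   ≈⟨ -‿involutive (x * y) ⟩
    x * y         ∎

  *-differences : ∀ x y z w → (x - y) * (z - w) ≈ (x * z + y * w) - (x * w + y * z)
  *-differences x y z w = begin
    (x - y) * (z - w)                             ≈⟨ distribʳ (z - w) x (- y) ⟩
    x * (z - w) + - y * (z - w)
      ≈⟨ +-cong (distribˡ x z (- w)) (trans (distribˡ (- y) z (- w)) (+-comm _ _)) ⟩
    (x * z + x * - w) + (- y * - w + - y * z)     ≈⟨ interchange _ _ _ _ ⟩
    (x * z + - y * - w) + (x * - w + - y * z)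
      ≈⟨ +-cong (+-congˡ (neg-*-neg y w)) (+-cong (sym (-‿distribʳ-* x w)) (sym (-‿distribˡ-* y z))) ⟩
    (x * z + y * w) + (- (x * w) - y * z)         ≈⟨ +-congˡ (⁻¹-∙-comm _ _) ⟩
    (x * z + y * w) - (x * w + y * z)             ∎

  ·1-+-* : ∀ m n m′ n′ → (m ℕ.* n ℕ.+ m′ ℕ.* n′) · 1# ≈ (m · 1#) * (n · 1#) + (m′ · 1#) * (n′ · 1#)
  ·1-+-* m n m′ n′ =
    trans (×-homo-+ 1# (m ℕ.* n) (m′ ℕ.* n′)) (+-cong (×1-homo-* m n) (×1-homo-* m′ n′))

  embed-* : ∀ i j → embed (i ℤ.* j) ≈ embed i * embed j
  embed-* (m , n) (m′ , n′) =
    trans (+-cong (·1-+-* m m′ n n′) (-‿cong (·1-+-* m n′ n m′))) (sym (*-differences _ _ _ _))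

  embed-cong : ∀ m n m′ n′ → m ℕ.+ n′ ≡ m′ ℕ.+ n → embed (m , n) ≈ embed (m′ , n′)
  embed-cong m n m′ n′ eq = x≈z//y _ _ _ (begin
    (m · 1# - n · 1#) + n′ · 1#   ≈⟨ +-assoc _ _ _ ⟩
    m · 1# + (- (n · 1#) + n′ · 1#)
                                  ≈⟨ +-congˡ (+-comm _ _) ⟩
    m · 1# + (n′ · 1# - n · 1#)   ≈⟨ +-assoc _ _ _ ⟨
    (m · 1# + n′ · 1#) - n · 1#   ≈⟨ +-congʳ (×-homo-+ 1# m n′) ⟨
    (m ℕ.+ n′) · 1# - n · 1#      ≡⟨ cong (λ k → k · 1# - n · 1#) eq ⟩
    (m′ ℕ.+ n) · 1# - n · 1#      ≈⟨ +-congʳ (×-homo-+ 1# m′ n) ⟩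
    (m′ · 1# + n · 1#) - n · 1#   ≈⟨ +-assoc _ _ _ ⟩
    m′ · 1# + (n · 1# - n · 1#)   ≈⟨ +-congˡ (-‿inverseʳ _) ⟩
    m′ · 1# + 0#                  ≈⟨ +-identityʳ _ ⟩
    m′ · 1#                       ∎)

  -- Unlike embed, it sends 0 and 1 to 0# and 1# definitionally, so that these
  -- constants can be used in solver expressions.
  embed′ : ℕ × ℕ → Carrier
  embed′ (m , zero)  = m ·′ 1#
  embed′ (m , suc n) = embed (m , suc n)

  embed′≈embed : ∀ i → embed′ i ≈ embed i
  embed′≈embed (m , zero)  = begin
    m ·′ 1#          ≈⟨ ×ᵤ≈× m 1# ⟨
    m · 1#           ≈⟨ +-identityʳ _ ⟨
    m · 1# + 0#      ≈⟨ +-congˡ ε⁻¹≈ε ⟨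
    m · 1# - 0#      ∎
  embed′≈embed (m , suc n) = refl

  morphism : differences -Raw-AlmostCommutative⟶ fromCommutativeRing R
  morphism = record
    { ⟦_⟧    = embed′
    ; +-homo = λ i j → trans (embed′≈embed (i ℤ.+ j))
        (trans (embed-+ i j) (+-cong (sym (embed′≈embed i)) (sym (embed′≈embed j))))
    ; *-homo = λ i j → trans (embed′≈embed (i ℤ.* j))
        (trans (embed-* i j) (*-cong (sym (embed′≈embed i)) (sym (embed′≈embed j))))
    ; -‿homo = λ i → trans (embed′≈embed (ℤ.- i))
        (trans (sym (⁻¹-anti-homo‿- _ _)) (-‿cong (sym (embed′≈embed i))))
    ; 0-homo = refl
    ; 1-homo = refl
    }

  -- Different integers can still have equal images in `R`, for instance in positive characteristic,
  -- so a failed comparison yields no answer rather than a refutation.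
  embed≟ : WeaklyDecidable (Induced-equivalence morphism)
  embed≟ (m , n) (m′ , n′) with m ℕ.+ n′ ℕ.≟ m′ ℕ.+ n
  ... | yes eq = just (trans (embed′≈embed (m , n))
    (trans (embed-cong m n m′ n′ eq) (sym (embed′≈embed (m′ , n′)))))
  ... | no  _  = nothing

  open Solver differences (fromCommutativeRing R) morphism embed≟ public
    using (solve; _:=_; _:+_; _:*_; _:-_; :-_; _:^_; con; Polynomial)

  :0 :1 : ∀ {k} → Polynomial k
  :0 = con (0 , 0)
  :1 = con (1 , 0)

-- Sums over lists and the recurrence for the coefficients

module ListSum {c ℓ} (R : CommutativeRing c ℓ) {a} {A : Set a} (f : A → CommutativeRing.Carrier R) where
  open CommutativeRing R hiding (zero)
  open SetoidReasoning setoid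

  sumOver : List A → Carrier
  sumOver xs = List.foldr _+_ 0# (List.map f xs)

  sumOver-↭ : ∀ {xs ys} → xs ↭ ys → sumOver xs ≈ sumOver ys
  sumOver-↭ ↭.refl          = refl
  sumOver-↭ (↭.prep x p)    = +-congˡ (sumOver-↭ p)
  sumOver-↭ (↭.swap {xs} {ys} x y p) = begin
    f x + (f y + sumOver xs)   ≈⟨ +-assoc _ _ _ ⟨
    (f x + f y) + sumOver xs   ≈⟨ +-cong (+-comm _ _) (sumOver-↭ p) ⟩
    (f y + f x) + sumOver ys   ≈⟨ +-assoc _ _ _ ⟩
    f y + (f x + sumOver ys)   ∎
  sumOver-↭ (↭.trans p q) = trans (sumOver-↭ p) (sumOver-↭ q)

  sumOver-++ : ∀ xs ys → sumOver (xs ++ ys) ≈ sumOver xs + sumOver ys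
  sumOver-++ []       ys = sym (+-identityˡ _)
  sumOver-++ (x ∷ xs) ys = trans (+-congˡ (sumOver-++ xs ys)) (sym (+-assoc _ _ _))

module _ {c ℓ} (R : CommutativeRing c ℓ) where
  open CommutativeRing R hiding (zero)
  open SetoidReasoning setoid
  open ListSum R
  open Exp semiring using (_^_)
  open IntegerSolver R
  open PowerSeries R
  open GeneratingFunction R

  sumOver-map : ∀ {a b} {A : Set a} {B : Set b} {f : B → Carrier} {g : A → Carrier} (h : A → B) k →
                (∀ x → f (h x) ≈ k * g x) → ∀ xs → sumOver f (List.map h xs) ≈ k * sumOver g xs
  sumOver-map h k f∘h≈kg []       = sym (zeroʳ k)
  sumOver-map h k f∘h≈kg (x ∷ xs) =
    trans (+-cong (f∘h≈kg x) (sumOver-map h k f∘h≈kg xs)) (sym (distribˡ k _ _))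

  1^n≈1 : ∀ n → 1# ^ n ≈ 1#
  1^n≈1 zero    = refl
  1^n≈1 (suc n) = trans (*-identityˡ _) (1^n≈1 n)

  module _ (p q u v s t : Carrier) {n} (π : Word (suc n)) where

    -- The new minimum is the only left-to-right minimum, so the power of `s` coming from `π` is
    -- lost. Setting `s` to `1#` in the weight of `π` records this.
    weight-prependMin : weight p q u v s t (prependMin π) ≈ p * t * (u * s) * weight p q u v 1# t π
    weight-prependMin
      rewrite asc-prepend-above zero π (prependMin-above π) | des-prepend-above zero π (prependMin-above π)
            | lrmax-prepend-above zero π (prependMin-above π) | rlmax-prepend-above zero π (prependMin-above π)
            | lrmin-prepend-above zero π (prependMin-above π) | rlmin-prepend-above zero π (prependMin-above π) = begin
      p * P * Q * (u * U) * V * (s * 1#) * (t * T)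
        ≈⟨ solve 9 (λ p P Q u U V s t T →
             p :* P :* Q :* (u :* U) :* V :* (s :* :1) :* (t :* T) :=
             p :* t :* (u :* s) :* (P :* Q :* U :* V :* :1 :* T)) refl p P Q u U V s t T ⟩
      p * t * (u * s) * (P * Q * U * V * 1# * T)
        -- The factor `1#` is written as `1# ^ lrmin π` to recover the form of a weight.
        ≈⟨ *-congˡ (*-congʳ (*-congˡ (1^n≈1 (lrmin π)))) ⟨
      p * t * (u * s) * (P * Q * U * V * 1# ^ lrmin π * T) ∎
      where
      P = p ^ asc π ; Q = q ^ des π ; U = u ^ lrmax π ; V = v ^ rlmax π ; T = t ^ rlmin π

    weight-prependMax : weight p q u v s t (prependMax π) ≈ q * v * (u * s) * weight p q 1# v s t π
    weight-prependMax
      rewrite asc-prepend-below _ π (prependMax-below π) | des-prepend-below _ π (prependMax-below π)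
            | lrmax-prepend-below _ π (prependMax-below π) | rlmax-prepend-below _ π (prependMax-below π)
            | lrmin-prepend-below _ π (prependMax-below π) | rlmin-prepend-below _ π (prependMax-below π) = begin
      P * (q * Q) * (u * 1#) * (v * V) * (s * S′) * T
        ≈⟨ solve 9 (λ P q Q u v V s S T →
             P :* (q :* Q) :* (u :* :1) :* (v :* V) :* (s :* S) :* T :=
             q :* v :* (u :* s) :* (P :* Q :* :1 :* V :* S :* T)) refl P q Q u v V s S′ T ⟩
      q * v * (u * s) * (P * Q * 1# * V * S′ * T)
        ≈⟨ *-congˡ (*-congʳ (*-congʳ (*-congʳ (*-congˡ (1^n≈1 (lrmax π)))))) ⟨
      q * v * (u * s) * (P * Q * 1# ^ lrmax π * V * S′ * T) ∎
      where
      P = p ^ asc π ; Q = q ^ des π ; V = v ^ rlmax π ; S′ = s ^ lrmin π ; T = t ^ rlmin π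

  F-suc : ∀ p q u v s t n → F p q u v s t [213] [231] (suc (suc n)) ≈
          p * t * (u * s) * F p q u v 1# t [213] [231] (suc n) +
          q * v * (u * s) * F p q 1# v s t [213] [231] (suc n)
  F-suc p q u v s t n = begin
    sumOver w (S (suc (suc n)) [213] [231])
      ≈⟨ sumOver-↭ w (S-suc-↭ n) ⟩
    sumOver w (List.map prependMin πs ++ List.map prependMax πs)
      ≈⟨ sumOver-++ w (List.map prependMin πs) (List.map prependMax πs) ⟩
    sumOver w (List.map prependMin πs) + sumOver w (List.map prependMax πs)
      ≈⟨ +-cong (sumOver-map prependMin _ (weight-prependMin p q u v s t) πs)
                (sumOver-map prependMax _ (weight-prependMax p q u v s t) πs) ⟩
    p * t * (u * s) * sumOver (weight p q u v 1# t) πs + q * v * (u * s) * sumOver (weight p q 1# v s t) πs ∎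
    where
    w : ∀ {n} → Word n → Carrier
    w = weight p q u v s t
    πs = S (suc n) [213] [231]

-- Products of polynomials as power series

module PolynomialProduct {c ℓ} (R : CommutativeRing c ℓ) where
  open CommutativeRing R hiding (zero)
  open PowerSeries R
  open Sum semiring using (sum-cong-≋)
  open IntegerSolver R

  *ˢ-congʳ : ∀ {f g} h → f ≈ˢ g → f *ˢ h ≈ˢ g *ˢ h
  *ˢ-congʳ {f} {g} h f≈g n =
    sum-cong-≋ {suc n} {λ i → f (toℕ i) * h (n ℕ.∸ toℕ i)} {λ i → g (toℕ i) * h (n ℕ.∸ toℕ i)}
      λ i → *-congʳ (f≈g (toℕ i))

  poly[]-*ˢ : ∀ f n → (poly [] *ˢ f) n ≈ 0#
  poly[]-*ˢ f zero    = trans (+-identityʳ _) (zeroˡ _)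
  poly[]-*ˢ f (suc n) = trans (+-cong (zeroˡ _) (poly[]-*ˢ f n)) (+-identityˡ _)

  module _ (x y z : Carrier) where

    poly-quadratic : poly (1# ∷ x ∷ []) *ˢ poly (1# ∷ y ∷ []) ≈ˢ poly (1# ∷ x + y ∷ x * y ∷ [])
    poly-quadratic 0 = solve 0 (:1 :* :1 :+ :0 := :1) refl
    poly-quadratic 1 = solve 2 (λ x y → :1 :* y :+ (x :* :1 :+ :0) := x :+ y) refl x y
    poly-quadratic 2 = solve 2 (λ x y → :1 :* :0 :+ (x :* y :+ (:0 :* :1 :+ :0)) := x :* y) refl x y
    -- Past the coefficients of the left factor, the rest of the convolution is itself a product
    -- with `poly []`.
    poly-quadratic (suc (suc (suc n))) = trans
      (+-congˡ (+-congˡ (poly[]-*ˢ (poly (1# ∷ y ∷ [])) (suc n))))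
      (solve 1 (λ x → :1 :* :0 :+ (x :* :0 :+ :0) := :0) refl x)

    poly-cubic : poly (1# ∷ x ∷ []) *ˢ poly (1# ∷ y ∷ []) *ˢ poly (1# ∷ z ∷ []) ≈ˢ
                 poly (1# ∷ x + y + z ∷ x * y + x * z + y * z ∷ x * y * z ∷ [])
    poly-cubic n = trans (*ˢ-congʳ (poly (1# ∷ z ∷ [])) poly-quadratic n) (product n)
      where
      product : poly (1# ∷ x + y ∷ x * y ∷ []) *ˢ poly (1# ∷ z ∷ []) ≈ˢ
                poly (1# ∷ x + y + z ∷ x * y + x * z + y * z ∷ x * y * z ∷ [])
      product 0 = solve 0 (:1 :* :1 :+ :0 := :1) refl
      product 1 = solve 3 (λ x y z → :1 :* z :+ ((x :+ y) :* :1 :+ :0) := x :+ y :+ z) refl x y z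
      product 2 = solve 3 (λ x y z →
        :1 :* :0 :+ ((x :+ y) :* z :+ (x :* y :* :1 :+ :0)) := x :* y :+ x :* z :+ y :* z) refl x y z
      product 3 = solve 3 (λ x y z →
        :1 :* :0 :+ ((x :+ y) :* :0 :+ (x :* y :* z :+ (:0 :* :1 :+ :0))) := x :* y :* z) refl x y z
      product (suc (suc (suc (suc n)))) = trans
        (+-congˡ (+-congˡ (+-congˡ (poly[]-*ˢ (poly (1# ∷ z ∷ [])) (suc n)))))
        (solve 2 (λ x y → :1 :* :0 :+ ((x :+ y) :* :0 :+ (x :* y :* :0 :+ :0)) := :0) refl x y)

-- Closed forms for the specialised generating functions

module ClosedForm {c ℓ} (R : CommutativeRing c ℓ) (p q u v s t : CommutativeRing.Carrier R) where
  open CommutativeRing R hiding (zero)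
  open IntegerSolver R
  open PowerSeries R
  open GeneratingFunction R
  open PolynomialProduct R

  -- `α`, `β` and `γ` are the coefficients in the three factors of the denominator; `a` and `b` are
  -- the factors of the recurrence with `u * s` removed.
  a b α β γ : Carrier
  a = p * t
  b = q * v
  α = a * u
  β = a + b
  γ = b * s

  -- The sequence of coefficients of 1 / ((1 − αx)(1 − βx)(1 − γx)), preceded by two
  -- zeros so that identities in three consecutive terms hold from the start.
  h : ℕ → Carrier
  h 0 = 0#
  h 1 = 0#
  h 2 = 1#
  h (suc (suc (suc n))) =
    (α + β + γ) * h (suc (suc n)) - (α * β + α * γ + β * γ) * h (suc n) + α * β * γ * h n

  D⁻¹ : Series
  D⁻¹ n = h (2 ℕ.+ n)

  infix 8 _⋆_
  -- The convolution of a finite list with `h`, by recursion on the list, so that a list of fixed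
  -- length gives a fixed number of terms.
  _⋆_ : List Carrier → ℕ → Carrier
  []       ⋆ n     = 0#
  (c ∷ cs) ⋆ zero  = c * h 0 + 0#
  (c ∷ cs) ⋆ suc n = c * h (suc n) + cs ⋆ n

  ⋆-0 : ∀ cs → cs ⋆ 0 ≈ 0#
  ⋆-0 []       = refl
  ⋆-0 (c ∷ cs) = trans (+-identityʳ _) (zeroʳ c)

  ⋆-1 : ∀ cs → cs ⋆ 1 ≈ 0#
  ⋆-1 []       = refl
  ⋆-1 (c ∷ cs) = trans (+-cong (zeroʳ c) (⋆-0 cs)) (+-identityˡ 0#)

  poly-*ˢ-D⁻¹ : ∀ cs n → (poly cs *ˢ D⁻¹) n ≈ cs ⋆ (2 ℕ.+ n)
  poly-*ˢ-D⁻¹ []       n       = poly[]-*ˢ D⁻¹ n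
  -- The product ends after one term, while `⋆` runs on into the two leading zeros of `h`.
  poly-*ˢ-D⁻¹ (c ∷ cs) zero    = +-congˡ (sym (⋆-1 cs))
  poly-*ˢ-D⁻¹ (c ∷ cs) (suc n) = +-congˡ (poly-*ˢ-D⁻¹ cs n)

  [c]⋆n : ∀ c n → (c ∷ []) ⋆ n ≡ c * h n + 0#
  [c]⋆n c zero    = ≡.refl
  [c]⋆n c (suc n) = ≡.refl

  -- The leading zeros of `h` stand in for negative indices, so the same four-term formula serves
  -- every coefficient from the first on.
  cubic-*ˢ-D⁻¹ : ∀ c₀ c₁ c₂ c₃ n → (poly (c₀ ∷ c₁ ∷ c₂ ∷ c₃ ∷ []) *ˢ D⁻¹) (suc n) ≈
               c₀ * h (3 ℕ.+ n) + (c₁ * h (2 ℕ.+ n) + (c₂ * h (1 ℕ.+ n) + (c₃ * h n + 0#)))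
  cubic-*ˢ-D⁻¹ c₀ c₁ c₂ c₃ n = trans (poly-*ˢ-D⁻¹ (c₀ ∷ c₁ ∷ c₂ ∷ c₃ ∷ []) (suc n))
    (+-congˡ (+-congˡ (+-congˡ (reflexive ([c]⋆n c₃ n)))))

  -- The recurrence of `h` in solver syntax; `h₀`, `h₁`, `h₂` stand for three consecutive terms.
  :h₃ : ∀ {k} (a b u s h₀ h₁ h₂ : Polynomial k) → Polynomial k
  :h₃ a b u s h₀ h₁ h₂ = let α = a :* u ; β = a :+ b ; γ = b :* s in
    (α :+ β :+ γ) :* h₂ :- (α :* β :+ α :* γ :+ β :* γ) :* h₁ :+ α :* β :* γ :* h₀

  :F₁₁ :Fᵤ₁ :F₁ₛ :Fᵤₛ : ∀ {k} (a b u v s t h₀ h₁ h₂ : Polynomial k) → Polynomial k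
  :F₁₁ a b u v s t h₀ h₁ h₂ =
    v :* t :* (h₂ :- (a :* u :+ b :* s) :* h₁ :+ a :* u :* (b :* s) :* h₀)
  :Fᵤ₁ a b u v s t h₀ h₁ h₂ =
    u :* v :* t :* (h₂ :- (a :+ b :* s) :* h₁ :+ a :* (b :* s) :* h₀)
  :F₁ₛ a b u v s t h₀ h₁ h₂ =
    v :* s :* t :* (h₂ :- (a :* u :+ b) :* h₁ :+ a :* u :* b :* h₀)
  :Fᵤₛ a b u v s t h₀ h₁ h₂ =
    u :* v :* s :* t :* (h₂ :- (a :+ b) :* h₁ :+ a :* b :* (u :+ s :- u :* s) :* h₀)

  -- F₁₁ is x v t / (1 − βx), Fᵤ₁ is x u v t (1 − a x) / ((1 − αx)(1 − βx)), and F₁ₛ is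
  -- symmetric; the numerators below come from the common denominator.
  F₁₁ : ∀ n → F p q 1# v 1# t [213] [231] (suc n) ≈
              v * t * (h (2 ℕ.+ n) - (α + γ) * h (1 ℕ.+ n) + α * γ * h n)
  -- The one permutation of length one has no ascent or descent and value 1 for the other four
  -- statistics; `h` starts with 0, 0, 1.
  F₁₁ zero = solve 6 (λ a b u v s t →
    :1 :* :1 :* (:1 :* :1) :* (v :* :1) :* (:1 :* :1) :* (t :* :1) :+ :0
      := :F₁₁ a b u v s t :0 :0 :1) refl a b u v s t
  F₁₁ (suc n) = trans (F-suc R p q 1# v 1# t n) (trans (+-cong (*-congˡ (F₁₁ n)) (*-congˡ (F₁₁ n)))
    (solve 9 (λ a b u v s t h₀ h₁ h₂ →
       a :* (:1 :* :1) :* :F₁₁ a b u v s t h₀ h₁ h₂ :+ b :* (:1 :* :1) :* :F₁₁ a b u v s t h₀ h₁ h₂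
         := :F₁₁ a b u v s t h₁ h₂ (:h₃ a b u s h₀ h₁ h₂))
       refl a b u v s t (h n) (h (1 ℕ.+ n)) (h (2 ℕ.+ n))))

  Fᵤ₁ : ∀ n → F p q u v 1# t [213] [231] (suc n) ≈
              u * v * t * (h (2 ℕ.+ n) - (a + γ) * h (1 ℕ.+ n) + a * γ * h n)
  Fᵤ₁ zero = solve 6 (λ a b u v s t →
    :1 :* :1 :* (u :* :1) :* (v :* :1) :* (:1 :* :1) :* (t :* :1) :+ :0
      := :Fᵤ₁ a b u v s t :0 :0 :1) refl a b u v s t
  Fᵤ₁ (suc n) = trans (F-suc R p q u v 1# t n) (trans (+-cong (*-congˡ (Fᵤ₁ n)) (*-congˡ (F₁₁ n)))
    (solve 9 (λ a b u v s t h₀ h₁ h₂ →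
       a :* (u :* :1) :* :Fᵤ₁ a b u v s t h₀ h₁ h₂ :+ b :* (u :* :1) :* :F₁₁ a b u v s t h₀ h₁ h₂
         := :Fᵤ₁ a b u v s t h₁ h₂ (:h₃ a b u s h₀ h₁ h₂))
       refl a b u v s t (h n) (h (1 ℕ.+ n)) (h (2 ℕ.+ n))))

  F₁ₛ : ∀ n → F p q 1# v s t [213] [231] (suc n) ≈
              v * s * t * (h (2 ℕ.+ n) - (α + b) * h (1 ℕ.+ n) + α * b * h n)
  F₁ₛ zero = solve 6 (λ a b u v s t →
    :1 :* :1 :* (:1 :* :1) :* (v :* :1) :* (s :* :1) :* (t :* :1) :+ :0
      := :F₁ₛ a b u v s t :0 :0 :1) refl a b u v s t
  F₁ₛ (suc n) = trans (F-suc R p q 1# v s t n) (trans (+-cong (*-congˡ (F₁₁ n)) (*-congˡ (F₁ₛ n)))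
    (solve 9 (λ a b u v s t h₀ h₁ h₂ →
       a :* (:1 :* s) :* :F₁₁ a b u v s t h₀ h₁ h₂ :+ b :* (:1 :* s) :* :F₁ₛ a b u v s t h₀ h₁ h₂
         := :F₁ₛ a b u v s t h₁ h₂ (:h₃ a b u s h₀ h₁ h₂))
       refl a b u v s t (h n) (h (1 ℕ.+ n)) (h (2 ℕ.+ n))))

  -- Over the common denominator, the quadratic coefficient of the bracket is αb + aγ - αγ = ab(u +
  -- s - us), and the cubic one cancels because β = a + b.
  Fᵤₛ : ∀ n → F p q u v s t [213] [231] (suc n) ≈
              u * v * s * t * (h (2 ℕ.+ n) - β * h (1 ℕ.+ n) + a * b * (u + s - u * s) * h n)
  Fᵤₛ zero = solve 6 (λ a b u v s t →
    :1 :* :1 :* (u :* :1) :* (v :* :1) :* (s :* :1) :* (t :* :1) :+ :0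
      := :Fᵤₛ a b u v s t :0 :0 :1) refl a b u v s t
  Fᵤₛ (suc n) = trans (F-suc R p q u v s t n) (trans (+-cong (*-congˡ (Fᵤ₁ n)) (*-congˡ (F₁ₛ n)))
    (solve 9 (λ a b u v s t h₀ h₁ h₂ →
       a :* (u :* s) :* :Fᵤ₁ a b u v s t h₀ h₁ h₂ :+ b :* (u :* s) :* :F₁ₛ a b u v s t h₀ h₁ h₂
         := :Fᵤₛ a b u v s t h₁ h₂ (:h₃ a b u s h₀ h₁ h₂))
       refl a b u v s t (h n) (h (1 ℕ.+ n)) (h (2 ℕ.+ n))))

-- The generating function as a quotient

theorem9 : ∀ {c ℓ} (R : CommutativeRing c ℓ) (p q u v s t : CommutativeRing.Carrier R) →
  let open CommutativeRing R
      open Exp semiring using (_^_)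
      open PowerSeries R
      open GeneratingFunction R p q u v s t
      A = poly
        ( 1#
        ∷ - (p * t) - p * t * u - q * v - q * s * v + s * t * u * v
        ∷ p ^ 2 * t ^ 2 * u + p * q * s * t * v + p * q * t * u * v + p * q * s * t * u * v
            - p * s * t ^ 2 * u * v + q ^ 2 * s * v ^ 2 - q * s * t * u * v ^ 2
        ∷ - (p ^ 2 * q * s * t ^ 2 * u * v) - p * q ^ 2 * s * t * u * v ^ 2
            + p * q * s ^ 2 * t ^ 2 * u * v ^ 2 + p * q * s * t ^ 2 * u ^ 2 * v ^ 2
            - p * q * s ^ 2 * t ^ 2 * u ^ 2 * v ^ 2
        ∷ [])
      D = poly (1# ∷ - (p * t * u) ∷ [])
            *ˢ poly (1# ∷ - (p * t) - q * v ∷ [])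
            *ˢ poly (1# ∷ - (q * s * v) ∷ [])
  in IsQuotient (F [213] [231]) A D
theorem9 R p q u v s t = D⁻¹ , D*D⁻¹≈1 , F≈A*D⁻¹
  where
  open CommutativeRing R hiding (zero)
  open IntegerSolver R
  open PowerSeries R
  open GeneratingFunction R p q u v s t
  open PolynomialProduct R
  open ClosedForm R p q u v s t using (h; D⁻¹; :h₃; :Fᵤₛ; Fᵤₛ; cubic-*ˢ-D⁻¹)

  x y z : Carrier
  x = - (p * t * u)
  y = - (p * t) - q * v
  z = - (q * s * v)

  D*D⁻¹≈1 : poly (1# ∷ x ∷ []) *ˢ poly (1# ∷ y ∷ []) *ˢ poly (1# ∷ z ∷ []) *ˢ D⁻¹ ≈ˢ 1ˢ
  D*D⁻¹≈1 n = trans (*ˢ-congʳ D⁻¹ (poly-cubic x y z) n) (cancel n)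
    where
    cancel : poly (1# ∷ x + y + z ∷ x * y + x * z + y * z ∷ x * y * z ∷ []) *ˢ D⁻¹ ≈ˢ 1ˢ
    cancel zero    = trans (+-identityʳ _) (*-identityˡ _)
    -- Here `x`, `y`, `z` are -α, -β, -γ, so the coefficient vanishes by the recurrence defining
    -- `h`.
    cancel (suc n) = trans (cubic-*ˢ-D⁻¹ _ _ _ _ n)
      (solve 9 (λ p q u v s t h₀ h₁ h₂ →
         let x = :- (p :* t :* u) ; y = :- (p :* t) :- q :* v ; z = :- (q :* s :* v) in
         :1 :* :h₃ (p :* t) (q :* v) u s h₀ h₁ h₂
         :+ ((x :+ y :+ z) :* h₂ :+ ((x :* y :+ x :* z :+ y :* z) :* h₁ :+ (x :* y :* z :* h₀ :+ :0)))
           := :0)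
         refl p q u v s t (h n) (h (1 ℕ.+ n)) (h (2 ℕ.+ n)))

  F≈A*D⁻¹ : F [213] [231] ≈ˢ poly (1# ∷ _ ∷ _ ∷ _ ∷ []) *ˢ D⁻¹
  -- The empty permutation contributes the constant term 1.
  F≈A*D⁻¹ zero    = solve 0 (:1 :* :1 :* :1 :* :1 :* :1 :* :1 :+ :0 := :1 :* :1 :+ :0) refl
  -- The numerator is the denominator plus uvst x (1 - βx + ab(u + s - us)x²). The denominator part
  -- vanishes by the recurrence of `h`, which leaves the closed form `Fᵤₛ`.
  F≈A*D⁻¹ (suc n) = trans (Fᵤₛ n) (trans
    (solve 9 (λ p q u v s t h₀ h₁ h₂ →
       :Fᵤₛ (p :* t) (q :* v) u v s t h₀ h₁ h₂ :=
       :1 :* :h₃ (p :* t) (q :* v) u s h₀ h₁ h₂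
       :+ ((:- (p :* t) :- p :* t :* u :- q :* v :- q :* s :* v :+ s :* t :* u :* v) :* h₂
       :+ ((p :^ 2 :* t :^ 2 :* u :+ p :* q :* s :* t :* v :+ p :* q :* t :* u :* v
              :+ p :* q :* s :* t :* u :* v :- p :* s :* t :^ 2 :* u :* v
              :+ q :^ 2 :* s :* v :^ 2 :- q :* s :* t :* u :* v :^ 2) :* h₁
       :+ ((:- (p :^ 2 :* q :* s :* t :^ 2 :* u :* v) :- p :* q :^ 2 :* s :* t :* u :* v :^ 2
              :+ p :* q :* s :^ 2 :* t :^ 2 :* u :* v :^ 2 :+ p :* q :* s :* t :^ 2 :* u :^ 2 :* v :^ 2
              :- p :* q :* s :^ 2 :* t :^ 2 :* u :^ 2 :* v :^ 2) :* h₀ :+ :0))))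
       refl p q u v s t (h n) (h (1 ℕ.+ n)) (h (2 ℕ.+ n)))
    (sym (cubic-*ˢ-D⁻¹ _ _ _ _ n)))
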